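{- Let $n\geq 14$ and let $S$ be a Steiner quadruple system S$(3,4,n)$ on the point set $\mathbb{Z}_n$, and let $A,B$ be a partition of $\mathbb{Z}_n$ into subsets of sizes $3$ and $n-3$, respectively. If there exists a perpendicular array PA$_\lambda(4,n-3,n-3)$, then there exists a large set with multiplicity LS$(3,4,n;\mu)$, where $\mu=\lambda\binom{n-4}{3}\big/4$.
   Context: A Steiner system S$(t,k,n)$ is a pair $(Q,B)$ where $Q$ is an $n$-set and $B$ is a collection of $k$-subsets (blocks) of $Q$ such that every $t$-subset of $Q$ is contained in exactly one block. A large set with multiplicity $\mu$, LS$(t,k,n;\mu)$, is a family (the same system may occur more than once) of Steiner systems S$(t,k,n)$ on a common $n$-set $Q$ such that every $k$-subset of $Q$ is a block of exactly $\mu$ of the systems. A perpendicular array PA$_\lambda(k,\ell,m)$ is a $\lambda\binom{m}{k}\times \ell$ matrix with entries from an $m$-set such that each row has $\ell$ distinct entries and, in the submatrix formed by any $k$ columns, each $k$-subset of the $m$-set occurs (as the set of entries of a row) exactly $\lambda$ times. -}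

module Defs where

open import Data.Bool.Properties using () renaming (_≟_ to _≟ᵇ_)
open import Data.Fin using (Fin)
open import Data.Fin.Properties using (_≟_; any?)
open import Data.Fin.Subset using (Subset; _∈_; _⊆_; ∣_∣)
open import Data.Fin.Subset.Properties using (_∈?_)
open import Data.List using (length; filter; allFin)
open import Data.Nat using (ℕ; _*_)
open import Data.Nat.Combinatorics using (_C_)
open import Data.Product using (∃!; _×_)
open import Data.Vec using (tabulate)
open import Data.Vec.Functional using (Vector)
open import Data.Vec.Properties using (≡-dec)
open import Function using (Injective)
open import Level using (0ℓ)
open import Relation.Binary.Definitions using (DecidableEquality)
open import Relation.Binary.PropositionalEquality using (_≡_)
open import Relation.Nullary using (does)
open import Relation.Nullary.Decidable using (_×-dec_)
open import Relation.Unary using (Pred; Decidable)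

countFin : ∀ {N} {P : Pred (Fin N) 0ℓ} → Decidable P → ℕ
countFin {N} P? = length (filter P? (allFin N))

_≟ˢ_ : ∀ {n} → DecidableEquality (Subset n)
_≟ˢ_ = ≡-dec _≟ᵇ_

image : ∀ {ℓ m} → (Fin ℓ → Fin m) → Subset ℓ → Subset m
image f K = tabulate λ y → does (any? λ x → (x ∈? K) ×-dec (f x ≟ y))

-- The collection of blocks is a set of subsets of Fin n (no repeated
-- blocks), given by its decidable membership predicate.
record SteinerSystem (t k n : ℕ) : Set₁ where
  field
    Block      : Pred (Subset n) 0ℓ
    block?     : Decidable Block
    block-size : ∀ {b} → Block b → ∣ b ∣ ≡ k
    cover      : ∀ (T : Subset n) → ∣ T ∣ ≡ t → ∃! _≡_ λ b → Block b × T ⊆ b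

-- The systems form an indexed family, so the same system may occur more
-- than once and is then counted with its multiplicity.
record LargeSet (t k n μ : ℕ) : Set₁ where
  field
    size     : ℕ
    system   : Fin size → SteinerSystem t k n
    multiple : ∀ (K : Subset n) → ∣ K ∣ ≡ k →
               countFin (λ i → SteinerSystem.block? (system i) K) ≡ μ

record PerpendicularArray (lam k ℓ m : ℕ) : Set where
  field
    matrix   : Vector (Vector (Fin m) ℓ) (lam * (m C k))
    distinct : ∀ r → Injective _≡_ _≡_ (matrix r)
    -- K is a set of columns and L a set of symbols.
    balanced : ∀ (K : Subset ℓ) (L : Subset m) → ∣ K ∣ ≡ k → ∣ L ∣ ≡ k →
               countFin (λ r → image (matrix r) K ≟ˢ L) ≡ lam

{-# OPTIONS --safe #-}

-- Put m = n − 3, fix three points of the system pointwise and let each row of the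
-- array permute the other m; the large set consists of the R = λ·C(m,4) relabelled
-- systems. A function on k-sets is determined by its sums over the k-subsets of the
-- (k+1)-sets when 2k+1 ≤ m (Gottlieb), so the 4-homogeneity of the rows passes to 3-,
-- 2- and 1-sets, and the number M(K) of systems with block K depends only on the trace
-- of K on the three fixed points. Every 3-set T lies in one block of each system, so
-- the M(T ∪ {x}), x ∉ T, sum to R. For T the three fixed points this reads m·μ = R,
-- where μ = M(T ∪ {x}); removing fixed points from T one at a time then gives
-- M(K) = μ for all K. Finally 4·μ = λ·C(m−1,3) by absorption.
module Submission where

open import Defs
open import Data.Bool using (Bool; true; false; if_then_else_)
open import Data.Fin using (Fin; zero; suc; punchOut; fromℕ<)
open import Data.Fin.Permutation
  using (Permutation′; permutation; _⟨$⟩ʳ_; _⟨$⟩ˡ_; inverseˡ; inverseʳ; lift₀)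
open import Data.Fin.Properties using (_≟_; any?; injective⇒≤; punchOut-injective)
open import Data.Fin.Subset using (Subset; ∣_∣; _∪_; _∩_; _⊆_; ⊤; ⊥)
open import Data.Fin.Subset.Properties
  using (_∈?_; ∣⊤∣≡n; ∣⊥∣≡0; ∣p∣≤n; p⊆q⇒∣p∣≤∣q∣; ∈⊤)
open import Data.Empty using (⊥-elim) renaming (⊥ to Empty)
open import Data.List using (length; filter)
import Data.List as List
open import Data.Nat using (ℕ; zero; suc; _+_; _≤_; _<_; _*_; _∸_; z≤n; s≤s; s≤s⁻¹)
open import Data.Nat.Combinatorics using (_C_; nCk+nC[k+1]≡[n+1]C[k+1]; nC1≡n)
open import Data.Nat.Properties hiding (_≟_)
import Data.Nat.Properties as ℕ
open import Data.Nat.Tactic.RingSolver using (solve-∀)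
open import Data.Product using (∃; ∃!; ∃-syntax; _×_; _,_; proj₁; proj₂)
open import Data.Vec using ([]; _∷_; lookup; tabulate; _[_]≔_)
open import Data.Vec.Functional using (Vector)
open import Data.Vec.Properties
  using (lookup∘tabulate; tabulate-cong; tabulate∘lookup; lookup∘update; lookup∘update′;
         lookup-replicate; []≔-idempotent; []≔-commutes; []≔-lookup; []=⇒lookup; lookup⇒[]=)
open import Function using (Injective; _∘_)
open import Level using (0ℓ)
open import Relation.Binary.PropositionalEquality
open import Relation.Nullary using (Dec; does; yes; no; contradiction)
open import Relation.Nullary.Decidable using (dec-true; dec-false; _×-dec_)
open import Relation.Unary using (Pred; Decidable)
open import Algebra.Properties.Semiring.Sum +-*-semiring
  using (sum; sum-cong-≗; ∑-comm; ∑-distrib-+; sum-permute; sum-replicate-zero;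
         *-distribˡ-sum; *-distribʳ-sum)

private
  variable
    m n k : ℕ

-- Finite sums over `Fin n` with Boolean guards.

when : Bool → ℕ → ℕ
when b v = if b then v else 0

unless : Bool → ℕ → ℕ
unless b v = if b then 0 else v

when-cong : ∀ b {u v} → (b ≡ true → u ≡ v) → when b u ≡ when b v
when-cong true  eq = eq refl
when-cong false eq = refl

when-+ : ∀ b u v → when b (u + v) ≡ when b u + when b v
when-+ true  u v = refl
when-+ false u v = refl

when-* : ∀ b v → when b v ≡ when b 1 * v
when-* true  v = sym (*-identityˡ v)
when-* false v = refl

∑-zero : (f : Vector ℕ n) → (∀ i → f i ≡ 0) → sum f ≡ 0
∑-zero {n} f f≡0 = trans (sum-cong-≗ f≡0) (sum-replicate-zero n)

∑-const : ∀ n c → sum {n} (λ _ → c) ≡ n * c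
∑-const zero    c = refl
∑-const (suc n) c = cong (c +_) (∑-const n c)

∑-single : (f : Vector ℕ n) (i : Fin n) → (∀ j → j ≢ i → f j ≡ 0) → sum f ≡ f i
∑-single f zero    f≡0 = trans (cong (f zero +_) (∑-zero (f ∘ suc) λ j → f≡0 (suc j) λ ()))
                               (+-identityʳ (f zero))
∑-single f (suc i) f≡0 = cong₂ _+_ (f≡0 zero λ ())
  (∑-single (f ∘ suc) i λ j j≢i → f≡0 (suc j) λ { refl → j≢i refl })

countFin≡∑ : ∀ {P : Pred (Fin n) 0ℓ} (P? : Decidable P) →
             countFin P? ≡ sum (λ i → when (does (P? i)) 1)
-- `allFin` tabulates the identity and the recursion composes with `suc`, so the claim is
-- generalised to any tabulated `g`.
countFin≡∑ P? = go (λ i → i)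
  where
  go : ∀ {l} (g : Fin l → Fin _) →
       length (filter P? (List.tabulate g)) ≡ sum (λ i → when (does (P? (g i))) 1)
  go {zero}  g = refl
  go {suc l} g with does (P? (g zero))
  ... | true  = cong suc (go (g ∘ suc))
  ... | false = go (g ∘ suc)

-- Subsets as Boolean vectors: insertion, deletion, inclusion and size.

lookup-injective : {K L : Subset n} → (∀ x → lookup K x ≡ lookup L x) → K ≡ L
lookup-injective {K = K} {L} eq =
  trans (sym (tabulate∘lookup K)) (trans (tabulate-cong eq) (tabulate∘lookup L))

∣∣≡∑ : (K : Subset n) → ∣ K ∣ ≡ sum (λ x → when (lookup K x) 1)
∣∣≡∑ []          = refl
∣∣≡∑ (true  ∷ K) = cong suc (∣∣≡∑ K)
∣∣≡∑ (false ∷ K) = ∣∣≡∑ K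

∣∣-insert : (K : Subset n) (x : Fin n) → lookup K x ≡ false → ∣ K [ x ]≔ true ∣ ≡ suc ∣ K ∣
∣∣-insert (false ∷ K) zero    x∉K = refl
∣∣-insert (true  ∷ K) (suc x) x∉K = cong suc (∣∣-insert K x x∉K)
∣∣-insert (false ∷ K) (suc x) x∉K = ∣∣-insert K x x∉K

insert∘delete : (K : Subset n) (x : Fin n) → lookup K x ≡ true →
                (K [ x ]≔ false) [ x ]≔ true ≡ K
insert∘delete K x x∈K = trans ([]≔-idempotent K x)
  (trans (cong (K [ x ]≔_) (sym x∈K)) ([]≔-lookup K x))

delete∘insert : (K : Subset n) (x : Fin n) → lookup K x ≡ false →
                (K [ x ]≔ true) [ x ]≔ false ≡ K
delete∘insert K x x∉K = trans ([]≔-idempotent K x)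
  (trans (cong (K [ x ]≔_) (sym x∉K)) ([]≔-lookup K x))

∣∣-delete : (K : Subset n) (x : Fin n) → lookup K x ≡ true → suc ∣ K [ x ]≔ false ∣ ≡ ∣ K ∣
∣∣-delete K x x∈K = trans (sym (∣∣-insert (K [ x ]≔ false) x (lookup∘update x K false)))
                          (cong ∣_∣ (insert∘delete K x x∈K))

-- Inclusion in terms of Boolean entries, the form to which the equations for `lookup` after an
-- update apply directly.
_⊑_ : Subset n → Subset n → Set
K ⊑ L = ∀ x → lookup K x ≡ true → lookup L x ≡ true

⊑-∉ : {K L : Subset n} → K ⊑ L → ∀ x → lookup L x ≡ false → lookup K x ≡ false
⊑-∉ {K = K} K⊑L x x∉L with lookup K x in eq
... | false = refl
... | true  = trans (sym (K⊑L x eq)) x∉L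

insert-⊑ : {K L : Subset n} {x : Fin n} → K ⊑ L → lookup L x ≡ true → (K [ x ]≔ true) ⊑ L
insert-⊑ {K = K} {x = x} K⊑L x∈L y y∈ with y ≟ x
... | yes refl = x∈L
... | no  y≢x  = K⊑L y (trans (sym (lookup∘update′ y≢x K true)) y∈)

delete-⊑ : (K : Subset n) (x : Fin n) → (K [ x ]≔ false) ⊑ K
delete-⊑ K x y y∈ with y ≟ x
... | yes refl = contradiction (trans (sym y∈) (lookup∘update x K false)) λ ()
... | no  y≢x  = trans (sym (lookup∘update′ y≢x K false)) y∈

lookup-⊤ : (x : Fin n) → lookup ⊤ x ≡ true
lookup-⊤ x = []=⇒lookup (∈⊤ {x = x})

-- Pigeonhole for arbitrary `K`: it serves to choose a fresh point, a point of a nonempty set (with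
-- `K` empty), and the point completing a set to a block.
find-outside : (K G : Subset n) → ∣ K ∣ < ∣ G ∣ →
               ∃ λ x → lookup K x ≡ false × lookup G x ≡ true
find-outside (false ∷ K) (true  ∷ G) lt = zero , refl , refl
find-outside (true  ∷ K) (true  ∷ G) lt with find-outside K G (s≤s⁻¹ lt)
... | x , p = suc x , p
find-outside (false ∷ K) (false ∷ G) lt with find-outside K G lt
... | x , p = suc x , p
find-outside (true  ∷ K) (false ∷ G) lt with find-outside K G (<-trans (n<1+n _) lt)
... | x , p = suc x , p

-- Inclusion matrices and their injectivity.

-- On sets of size k + 1 this is the inclusion matrix of k-sets against (k+1)-sets applied to `h`;
-- leaving `h` defined on all subsets avoids indexing by size.
shadow : (Subset n → ℕ) → Subset n → ℕ
shadow h L = sum λ x → when (lookup L x) (h (L [ x ]≔ false))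

shadow-+ : ∀ (h g : Subset n → ℕ) L → shadow (λ K → h K + g K) L ≡ shadow h L + shadow g L
shadow-+ h g L = trans
  (sum-cong-≗ λ x → when-+ (lookup L x) (h (L [ x ]≔ false)) (g (L [ x ]≔ false)))
  (∑-distrib-+ (λ x → when (lookup L x) (h (L [ x ]≔ false))) _)

shadow-const : ∀ c (L : Subset n) → shadow (λ _ → c) L ≡ ∣ L ∣ * c
shadow-const c L = begin
  sum (λ x → when (lookup L x) c)      ≡⟨ sum-cong-≗ (λ x → when-* (lookup L x) c) ⟩
  sum (λ x → when (lookup L x) 1 * c)  ≡⟨ *-distribʳ-sum c (λ x → when (lookup L x) 1) ⟨
  sum (λ x → when (lookup L x) 1) * c  ≡⟨ cong (_* c) (∣∣≡∑ L) ⟨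
  ∣ L ∣ * c                            ∎
  where open ≡-Reasoning

-- Deleting `p` from V ∪ p returns `V`; deleting any other point commutes with the insertion of `p`.
shadow-insert : ∀ (h : Subset n → ℕ) V p → lookup V p ≡ false →
                shadow h (V [ p ]≔ true) ≡ h V + shadow (λ U → h (U [ p ]≔ true)) V
shadow-insert h V p p∉V = begin
  sum (λ x → when (lookup W x) (h (W [ x ]≔ false)))
    ≡⟨ sum-cong-≗ split ⟩
  sum (λ x → when (does (x ≟ p)) (h V) + when (lookup V x) (h ((V [ x ]≔ false) [ p ]≔ true)))
    ≡⟨ ∑-distrib-+ (λ x → when (does (x ≟ p)) (h V)) _ ⟩
  sum (λ x → when (does (x ≟ p)) (h V)) + shadow (λ U → h (U [ p ]≔ true)) V
    ≡⟨ cong (_+ shadow (λ U → h (U [ p ]≔ true)) V)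
            (trans (∑-single _ p λ x x≢p → cong (λ b → when b (h V)) (dec-false (x ≟ p) x≢p))
                   (cong (λ b → when b (h V)) (dec-true (p ≟ p) refl))) ⟩
  h V + shadow (λ U → h (U [ p ]≔ true)) V ∎
  where
  open ≡-Reasoning
  W = V [ p ]≔ true
  split : ∀ x → when (lookup W x) (h (W [ x ]≔ false)) ≡
          when (does (x ≟ p)) (h V) + when (lookup V x) (h ((V [ x ]≔ false) [ p ]≔ true))
  split x with x ≟ p
  ... | yes refl rewrite lookup∘update x V true | p∉V | delete∘insert V x p∉V = sym (+-identityʳ _)
  ... | no  x≢p rewrite lookup∘update′ x≢p V true | []≔-commutes {x = true} {y = false} V p x (x≢p ∘ sym) = refl

-- Induction on k, with d = h − g: for x ∈ K and p ∉ K, the function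
-- U ↦ d (U ∪ p) − d (U ∪ x) on (k−1)-subsets of G ∖ {x , p} has vanishing shadow, so d is
-- invariant under exchanging x for p, and its sum over the k-subsets of K ∪ p is (k+1) d K.
-- The differences are split over h′ and g′ to stay in ℕ.
shadow-injective :
  ∀ k (G : Subset n) → suc (2 * k) ≤ ∣ G ∣ → (h g : Subset n → ℕ) →
  (∀ L → L ⊑ G → ∣ L ∣ ≡ suc k → shadow h L ≡ shadow g L) →
  ∀ K → K ⊑ G → ∣ K ∣ ≡ k → h K ≡ g K
shadow-injective {n} k G big h g eq K K⊑G ∣K∣≡k = conclude
  -- Since k < 2k + 1 ≤ |G|, some point `p` of `G` lies outside `K`.
  (find-outside K G (≤-trans (s≤s (≤-trans (≤-reflexive ∣K∣≡k) (m≤m+n k _))) big))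
  where
  open ≡-Reasoning

  exchange : ∀ {p} → lookup K p ≡ false → lookup G p ≡ true → ∀ x → lookup K x ≡ true →
             h ((K [ x ]≔ false) [ p ]≔ true) + g K ≡ h K + g ((K [ x ]≔ false) [ p ]≔ true)
  exchange {p} p∉K p∈G x x∈K = go k refl
    where
    U G′ : Subset n
    U  = K [ x ]≔ false
    G′ = (G [ x ]≔ false) [ p ]≔ false
    x≢p : x ≢ p
    x≢p refl = contradiction (trans (sym x∈K) p∉K) λ ()
    x∈G = K⊑G x x∈K
    G′⊑G : G′ ⊑ G
    G′⊑G y y∈ = delete-⊑ G x y (delete-⊑ (G [ x ]≔ false) p y y∈)
    x∉G′ : lookup G′ x ≡ false
    x∉G′ = trans (lookup∘update′ x≢p (G [ x ]≔ false) false) (lookup∘update x G false)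
    p∉G′ : lookup G′ p ≡ false
    p∉G′ = lookup∘update p (G [ x ]≔ false) false
    ∣G′∣ : 2 + ∣ G′ ∣ ≡ ∣ G ∣
    ∣G′∣ = trans (cong suc (∣∣-delete (G [ x ]≔ false) p
                   (trans (lookup∘update′ (x≢p ∘ sym) G false) p∈G)))
                 (∣∣-delete G x x∈G)
    U⊑G′ : U ⊑ G′
    U⊑G′ y y∈ with y ≟ p | y ≟ x
    ... | yes refl | _ = contradiction (trans (sym (delete-⊑ K x y y∈)) p∉K) λ ()
    ... | no _ | yes refl = contradiction (trans (sym y∈) (lookup∘update x K false)) λ ()
    ... | no y≢p | no y≢x = trans (lookup∘update′ y≢p (G [ x ]≔ false) false)
            (trans (lookup∘update′ y≢x G false) (K⊑G y (delete-⊑ K x y y∈)))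
    -- Splitting the copy `k′` exposes the predecessor `j` for the induction; k = 0 is impossible
    -- because `K` contains `x`.
    go : ∀ k′ → k′ ≡ k → h (U [ p ]≔ true) + g K ≡ h K + g (U [ p ]≔ true)
    go zero    refl = contradiction (trans (∣∣-delete K x x∈K) ∣K∣≡k) λ ()
    go (suc j) refl = begin
      h (U [ p ]≔ true) + g K                ≡⟨ cong (λ J → h (U [ p ]≔ true) + g J) U∪x≡K ⟨
      h (U [ p ]≔ true) + g (U [ x ]≔ true)  ≡⟨ shadow-injective j G′ big′ h′ g′ eq′ U U⊑G′ ∣U∣≡j ⟩
      h (U [ x ]≔ true) + g (U [ p ]≔ true)  ≡⟨ cong (λ J → h J + g (U [ p ]≔ true)) U∪x≡K ⟩
      h K + g (U [ p ]≔ true)                ∎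
      where
      U∪x≡K = insert∘delete K x x∈K
      h′ g′ : Subset n → ℕ
      h′ V = h (V [ p ]≔ true) + g (V [ x ]≔ true)
      g′ V = h (V [ x ]≔ true) + g (V [ p ]≔ true)
      ∣U∣≡j : ∣ U ∣ ≡ j
      ∣U∣≡j = suc-injective (trans (∣∣-delete K x x∈K) ∣K∣≡k)
      -- `G′` has two points fewer than `G`, and 2k + 1 also drops by two when k drops by one.
      big′ : suc (2 * j) ≤ ∣ G′ ∣
      big′ = s≤s⁻¹ (s≤s⁻¹ (subst₂ _≤_ (cong suc (*-suc 2 j)) (sym ∣G′∣) big))
      eq′ : ∀ V → V ⊑ G′ → ∣ V ∣ ≡ suc j → shadow h′ V ≡ shadow g′ V
      -- Adding `h V + g V` completes the partial shadows to full shadows at V ∪ p and V ∪ x, where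
      -- `h` and `g` agree by hypothesis.
      eq′ V V⊑G′ ∣V∣ = +-cancelˡ-≡ (h V + g V) _ _ (begin
        h V + g V + shadow h′ V  ≡⟨ cong (h V + g V +_) (shadow-+ (at h p) (at g x) V) ⟩
        h V + g V + (s h p + s g x) ≡⟨ shuffle (h V) (g V) (s h p) (s g x) ⟩
        (h V + s h p) + (g V + s g x) ≡⟨ cong₂ _+_ (ins h p∉G′) (ins g x∉G′) ⟨
        shadow h (V [ p ]≔ true) + shadow g (V [ x ]≔ true)
          ≡⟨ cong₂ _+_ (same p∉G′ p∈G) (sym (same x∉G′ x∈G)) ⟩
        shadow g (V [ p ]≔ true) + shadow h (V [ x ]≔ true)
          ≡⟨ cong₂ _+_ (ins g p∉G′) (ins h x∉G′) ⟩
        (g V + s g p) + (h V + s h x) ≡⟨ shuffle′ (h V) (g V) (s h x) (s g p) ⟩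
        h V + g V + (s h x + s g p) ≡⟨ cong (h V + g V +_) (shadow-+ (at h x) (at g p) V) ⟨
        h V + g V + shadow g′ V  ∎)
        where
        at : (Subset n → ℕ) → Fin n → Subset n → ℕ
        at f y W = f (W [ y ]≔ true)
        s : (Subset n → ℕ) → Fin n → ℕ
        s f y = shadow (at f y) V
        shuffle : ∀ a b c d → a + b + (c + d) ≡ (a + c) + (b + d)
        shuffle = solve-∀
        shuffle′ : ∀ a b c d → (b + d) + (a + c) ≡ a + b + (c + d)
        shuffle′ = solve-∀
        ∉V : ∀ {y} → lookup G′ y ≡ false → lookup V y ≡ false
        ∉V {y} = ⊑-∉ {K = V} {L = G′} V⊑G′ y
        ins : ∀ f {y} → lookup G′ y ≡ false → shadow f (V [ y ]≔ true) ≡ f V + s f y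
        ins f {y} y∉ = shadow-insert f V y (∉V y∉)
        same : ∀ {y} → lookup G′ y ≡ false → lookup G y ≡ true →
               shadow h (V [ y ]≔ true) ≡ shadow g (V [ y ]≔ true)
        same {y} y∉ y∈G = eq (V [ y ]≔ true)
          (insert-⊑ {K = V} {L = G} (λ z z∈ → G′⊑G z (V⊑G′ z z∈)) y∈G)
          (trans (∣∣-insert V y (∉V y∉)) (cong suc ∣V∣))

  conclude : (∃ λ p → lookup K p ≡ false × lookup G p ≡ true) → h K ≡ g K
  -- Exchanging turns the shadow equation at K ∪ p into (k+1) · h K = (k+1) · g K, up to the summand
  -- `s g` that is cancelled first.
  conclude (p , p∉K , p∈G) = *-cancelˡ-≡ (h K) (g K) (suc ∣ K ∣)
    (+-cancelʳ-≡ (s g) _ _ (sym (begin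
      (g K + ∣ K ∣ * g K) + s g ≡⟨ rearrange (g K) (∣ K ∣ * g K) (s g) ⟩
      (g K + s g) + ∣ K ∣ * g K ≡⟨ cong (_+ ∣ K ∣ * g K) sums ⟨
      (h K + s h) + ∣ K ∣ * g K ≡⟨ +-assoc (h K) (s h) _ ⟩
      h K + (s h + ∣ K ∣ * g K) ≡⟨ cong (h K +_) exchanged ⟩
      h K + (∣ K ∣ * h K + s g) ≡⟨ +-assoc (h K) _ (s g) ⟨
      (h K + ∣ K ∣ * h K) + s g ∎)))
    where
    s : (Subset n → ℕ) → ℕ
    s f = shadow (λ U → f (U [ p ]≔ true)) K
    rearrange : ∀ a b c → (a + b) + c ≡ (a + c) + b
    rearrange = solve-∀
    sums : h K + s h ≡ g K + s g
    sums = trans (sym (shadow-insert h K p p∉K))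
      (trans (eq (K [ p ]≔ true) (insert-⊑ {K = K} {L = G} K⊑G p∈G)
                 (trans (∣∣-insert K p p∉K) (cong suc ∣K∣≡k)))
             (shadow-insert g K p p∉K))
    exchanged : s h + ∣ K ∣ * g K ≡ ∣ K ∣ * h K + s g
    exchanged = begin
      s h + ∣ K ∣ * g K
        ≡⟨ cong (s h +_) (shadow-const (g K) K) ⟨
      s h + shadow (λ _ → g K) K
        ≡⟨ shadow-+ (λ U → h (U [ p ]≔ true)) (λ _ → g K) K ⟨
      shadow (λ U → h (U [ p ]≔ true) + g K) K
        ≡⟨ sum-cong-≗ (λ x → when-cong (lookup K x) (exchange p∉K p∈G x)) ⟩
      shadow (λ U → h K + g (U [ p ]≔ true)) K
        ≡⟨ shadow-+ (λ _ → h K) (λ U → g (U [ p ]≔ true)) K ⟩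
      shadow (λ _ → h K) K + s g
        ≡⟨ cong (_+ s g) (shadow-const (h K) K) ⟩
      ∣ K ∣ * h K + s g ∎

-- Preimages of subsets under permutations.

preimage : (Fin m → Fin n) → Subset n → Subset m
preimage f L = tabulate (lookup L ∘ f)

lookup-preimage : ∀ (f : Fin m → Fin n) L x → lookup (preimage f L) x ≡ lookup L (f x)
lookup-preimage f L = lookup∘tabulate (lookup L ∘ f)

preimage-∘ : ∀ {f : Fin m → Fin n} {g : Fin n → Fin m} → (∀ x → f (g x) ≡ x) →
             ∀ L → preimage g (preimage f L) ≡ L
preimage-∘ {f = f} {g} fg≡id L = lookup-injective λ x →
  trans (lookup-preimage g (preimage f L) x)
        (trans (lookup-preimage f L (g x)) (cong (lookup L) (fg≡id x)))

preimage-update : ∀ {f : Fin m → Fin n} → Injective _≡_ _≡_ f → ∀ L x {b} →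
                  preimage f (L [ f x ]≔ b) ≡ preimage f L [ x ]≔ b
preimage-update {f = f} f-inj L x {b} = lookup-injective λ y →
  trans (lookup-preimage f (L [ f x ]≔ b) y) (at y)
  where
  at : ∀ y → lookup (L [ f x ]≔ b) (f y) ≡ lookup (preimage f L [ x ]≔ b) y
  at y with y ≟ x
  ... | yes refl = trans (lookup∘update (f x) L b) (sym (lookup∘update x (preimage f L) b))
  ... | no  y≢x  = trans (lookup∘update′ (y≢x ∘ f-inj) L b)
    (trans (sym (lookup-preimage f L y)) (sym (lookup∘update′ y≢x (preimage f L) b)))

⟨$⟩ʳ-injective : (π : Permutation′ n) → Injective _≡_ _≡_ (π ⟨$⟩ʳ_)
⟨$⟩ʳ-injective π {x} {y} eq =
  trans (sym (inverseˡ π)) (trans (cong (π ⟨$⟩ˡ_) eq) (inverseˡ π))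

∣preimage∣ : ∀ (π : Permutation′ n) L → ∣ preimage (π ⟨$⟩ʳ_) L ∣ ≡ ∣ L ∣
∣preimage∣ π L = begin
  ∣ preimage (π ⟨$⟩ʳ_) L ∣                                ≡⟨ ∣∣≡∑ (preimage (π ⟨$⟩ʳ_) L) ⟩
  sum (λ x → when (lookup (preimage (π ⟨$⟩ʳ_) L) x) 1)
    ≡⟨ sum-cong-≗ (λ x → cong (λ b → when b 1) (lookup-preimage (π ⟨$⟩ʳ_) L x)) ⟩
  sum (λ x → when (lookup L (π ⟨$⟩ʳ x)) 1)                ≡⟨ sum-permute _ π ⟨
  sum (λ x → when (lookup L x) 1)                         ≡⟨ ∣∣≡∑ L ⟨
  ∣ L ∣                                                   ∎
  where open ≡-Reasoning

-- Deleting `x` from the preimage is pulling back `L` without π x, so the two sums differ by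
-- reindexing along π.
shadow-preimage : ∀ (π : Permutation′ n) ψ L →
  shadow ψ (preimage (π ⟨$⟩ʳ_) L) ≡ shadow (ψ ∘ preimage (π ⟨$⟩ʳ_)) L
shadow-preimage π ψ L = trans
  (sum-cong-≗ λ x → cong₂ (λ b J → when b (ψ J)) (lookup-preimage (π ⟨$⟩ʳ_) L x)
                          (sym (preimage-update (⟨$⟩ʳ-injective π) L x)))
  (sym (sum-permute (λ x → when (lookup L x) (ψ (preimage (π ⟨$⟩ʳ_) (L [ x ]≔ false)))) π))

-- Homogeneous families of permutations.

module _ {R} (σ : Fin R → Permutation′ n) where

  total : (Subset n → ℕ) → Subset n → ℕ
  total ψ L = sum λ r → ψ (preimage (σ r ⟨$⟩ʳ_) L)

  -- Arbitrary weights `ψ` are allowed, not only indicators, so that `shadow ψ` can itself be used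
  -- as a weight in the descent.
  Homogeneous : ℕ → Set
  Homogeneous k = ∀ ψ K L → ∣ K ∣ ≡ k → ∣ L ∣ ≡ k → total ψ K ≡ total ψ L

  shadow-total : ∀ ψ L → shadow (total ψ) L ≡ total (shadow ψ) L
  shadow-total ψ L = begin
    sum (λ x → when (lookup L x) (sum λ r → ψ (pre r (L [ x ]≔ false))))
      ≡⟨ sum-cong-≗ (λ x → when-∑ (lookup L x)) ⟩
    sum (λ x → sum λ r → when (lookup L x) (ψ (pre r (L [ x ]≔ false))))
      ≡⟨ ∑-comm (λ x r → when (lookup L x) (ψ (pre r (L [ x ]≔ false)))) ⟩
    sum (λ r → shadow (ψ ∘ pre r) L)
      ≡⟨ sum-cong-≗ (λ r → shadow-preimage (σ r) ψ L) ⟨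
    sum (λ r → shadow ψ (pre r L)) ∎
    where
    open ≡-Reasoning
    pre : Fin R → Subset n → Subset n
    pre r = preimage (σ r ⟨$⟩ʳ_)
    when-∑ : ∀ b {f : Vector ℕ R} → when b (sum f) ≡ sum (λ r → when b (f r))
    when-∑ true  = refl
    when-∑ false = sym (sum-replicate-zero R)

  -- The shadow of `total ψ` is `total (shadow ψ)`, which is constant on (k+1)-sets by hypothesis. A
  -- constant function has constant shadow too, so injectivity of the shadow makes `total ψ`
  -- constant on k-sets.
  homogeneous-pred : suc (2 * k) ≤ n → Homogeneous (suc k) → Homogeneous k
  homogeneous-pred {k} big hom ψ K L ∣K∣ ∣L∣ =
    *-cancelˡ-≡ (total ψ K) (total ψ L) (suc k) (trans (scaled K ∣K∣) (sym (scaled L ∣L∣)))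
    where
    open ≡-Reasoning
    big′ : suc (2 * k) ≤ ∣ ⊤ {n} ∣
    big′ = ≤-trans big (≤-reflexive (sym (∣⊤∣≡n n)))
    extra : ∃ λ p → lookup K p ≡ false × lookup (⊤ {n}) p ≡ true
    extra = find-outside K ⊤ (≤-trans (s≤s (≤-trans (≤-reflexive ∣K∣) (m≤m+n k _))) big′)
    K⁺ = K [ proj₁ extra ]≔ true
    ∣K⁺∣ : ∣ K⁺ ∣ ≡ suc k
    ∣K⁺∣ = trans (∣∣-insert K (proj₁ extra) (proj₁ (proj₂ extra))) (cong suc ∣K∣)
    -- The value on k-sets would be c / (k+1); multiplying `total ψ` by k + 1 avoids the division.
    c = total (shadow ψ) K⁺
    shadows : ∀ J → ∣ J ∣ ≡ suc k → shadow (λ U → suc k * total ψ U) J ≡ shadow (λ _ → c) J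
    shadows J ∣J∣ = begin
      shadow (λ U → suc k * total ψ U) J
        ≡⟨ sum-cong-≗ (λ x → when-scale (lookup J x) _) ⟩
      sum (λ x → suc k * when (lookup J x) (total ψ (J [ x ]≔ false)))
        ≡⟨ *-distribˡ-sum (suc k) (λ x → when (lookup J x) (total ψ (J [ x ]≔ false))) ⟨
      suc k * shadow (total ψ) J  ≡⟨ cong (suc k *_) (shadow-total ψ J) ⟩
      suc k * total (shadow ψ) J  ≡⟨ cong₂ _*_ (sym ∣J∣) (hom (shadow ψ) J K⁺ ∣J∣ ∣K⁺∣) ⟩
      ∣ J ∣ * c                   ≡⟨ shadow-const c J ⟨
      shadow (λ _ → c) J          ∎
      where
      when-scale : ∀ b v → when b (suc k * v) ≡ suc k * when b v
      when-scale true  v = refl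
      when-scale false v = sym (*-zeroʳ (suc k))
    scaled : ∀ J → ∣ J ∣ ≡ k → suc k * total ψ J ≡ c
    scaled J = shadow-injective k ⊤ big′ (λ U → suc k * total ψ U) (λ _ → c)
      (λ J _ → shadows J) J (λ x _ → lookup-⊤ x)

-- Sums over all subsets.

∑ˢ : ∀ {n} → (Subset n → ℕ) → ℕ
∑ˢ {zero}  f = f []
∑ˢ {suc n} f = ∑ˢ (f ∘ (true ∷_)) + ∑ˢ (f ∘ (false ∷_))

∑ˢ-cong : {f g : Subset n → ℕ} → (∀ K → f K ≡ g K) → ∑ˢ f ≡ ∑ˢ g
∑ˢ-cong {zero}  eq = eq []
∑ˢ-cong {suc n} eq = cong₂ _+_ (∑ˢ-cong (eq ∘ (true ∷_))) (∑ˢ-cong (eq ∘ (false ∷_)))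

∑ˢ-zero : (f : Subset n → ℕ) → (∀ K → f K ≡ 0) → ∑ˢ f ≡ 0
∑ˢ-zero {zero}  f eq = eq []
∑ˢ-zero {suc n} f eq = cong₂ _+_ (∑ˢ-zero _ (eq ∘ (true ∷_))) (∑ˢ-zero _ (eq ∘ (false ∷_)))

∑ˢ-single : (f : Subset n → ℕ) (K : Subset n) → (∀ J → J ≢ K → f J ≡ 0) → ∑ˢ f ≡ f K
∑ˢ-single f [] f≡0 = refl
∑ˢ-single f (true ∷ K) f≡0 = trans
  (cong₂ _+_ (∑ˢ-single _ K λ J J≢K → f≡0 (true ∷ J) λ { refl → J≢K refl })
             (∑ˢ-zero (f ∘ (false ∷_)) λ J → f≡0 (false ∷ J) λ ()))
  (+-identityʳ (f (true ∷ K)))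
∑ˢ-single f (false ∷ K) f≡0 =
  cong₂ _+_ (∑ˢ-zero (f ∘ (true ∷_)) λ J → f≡0 (true ∷ J) λ ())
            (∑ˢ-single _ K λ J J≢K → f≡0 (false ∷ J) λ { refl → J≢K refl })

∑-∑ˢ-comm : ∀ {R} (f : Fin R → Subset n → ℕ) →
            sum (λ r → ∑ˢ (f r)) ≡ ∑ˢ (λ K → sum λ r → f r K)
∑-∑ˢ-comm {zero}  f = refl
∑-∑ˢ-comm {suc n} f = trans
  (∑-distrib-+ (λ r → ∑ˢ (f r ∘ (true ∷_))) _)
  (cong₂ _+_ (∑-∑ˢ-comm (λ r → f r ∘ (true ∷_))) (∑-∑ˢ-comm (λ r → f r ∘ (false ∷_))))

-- Injections of a finite set into itself are permutations.

missed⇒⊥ : (f : Fin n → Fin n) → Injective _≡_ _≡_ f → ∀ y → (∀ x → y ≢ f x) → Empty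
missed⇒⊥ {suc n} f f-inj y miss =
  1+n≰n (injective⇒≤ {f = λ x → punchOut (miss x)} λ eq → f-inj (punchOut-injective (miss _) (miss _) eq))

injective⇒permutation : (f : Fin n → Fin n) → Injective _≡_ _≡_ f →
                        ∃ λ (π : Permutation′ n) → ∀ x → π ⟨$⟩ʳ x ≡ f x
injective⇒permutation f f-inj =
  permutation f (proj₁ ∘ surj) (proj₂ ∘ surj) (λ x → f-inj (proj₂ (surj (f x)))) , λ _ → refl
  where
  surj : ∀ y → ∃ λ x → f x ≡ y
  surj y with any? (λ x → f x ≟ y)
  ... | yes hit  = hit
  ... | no  miss = ⊥-elim (missed⇒⊥ f f-inj y λ x y≡fx → miss (x , sym y≡fx))

preimage-image : ∀ (π : Permutation′ n) K → preimage (π ⟨$⟩ʳ_) (image (π ⟨$⟩ʳ_) K) ≡ K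
preimage-image π K = lookup-injective λ x →
  trans (lookup-preimage f (image f K) x)
        (trans (lookup∘tabulate (λ y → does (any? λ z → (z ∈? K) ×-dec (f z ≟ y))) (f x)) (at x))
  where
  f = π ⟨$⟩ʳ_
  at : ∀ x → does (any? λ z → (z ∈? K) ×-dec (f z ≟ f x)) ≡ lookup K x
  at x with lookup K x in eq
  ... | true  = dec-true (any? λ z → (z ∈? K) ×-dec (f z ≟ f x)) (x , lookup⇒[]= x K eq , refl)
  ... | false = dec-false (any? λ z → (z ∈? K) ×-dec (f z ≟ f x)) λ (z , z∈K , fz≡fx) → contradiction
    (trans (sym ([]=⇒lookup z∈K)) (trans (cong (lookup K) (⟨$⟩ʳ-injective π fz≡fx)) eq)) λ ()

image-preimage : ∀ (π : Permutation′ n) L → image (π ⟨$⟩ʳ_) (preimage (π ⟨$⟩ʳ_) L) ≡ L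
image-preimage π L = begin
  image f (preimage f L)
    ≡⟨ preimage-∘ {f = f} {g} (λ x → inverseʳ π) (image f (preimage f L)) ⟨
  preimage g (preimage f (image f (preimage f L)))
    ≡⟨ cong (preimage g) (preimage-image π (preimage f L)) ⟩
  preimage g (preimage f L)
    ≡⟨ preimage-∘ {f = f} {g} (λ x → inverseʳ π) L ⟩
  L ∎
  where
  open ≡-Reasoning
  f = π ⟨$⟩ʳ_
  g = π ⟨$⟩ˡ_

-- Rows of a square perpendicular array are homogeneous.

module _ {lam k m} (P : PerpendicularArray lam k m m) where
  open PerpendicularArray P

  -- There are as many columns as symbols, so distinct entries make a row a permutation; its forward
  -- map computes to the row itself.
  rowPerm : Fin (lam * (m C k)) → Permutation′ m
  rowPerm r = proj₁ (injective⇒permutation (matrix r) (distinct r))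

  -- The rows are grouped by the unique column set `K` that each maps onto `L`, namely the preimage
  -- of `L`.
  total≡∑ˢ : ∀ ψ L → total rowPerm ψ L ≡
             ∑ˢ λ K → countFin (λ r → image (matrix r) K ≟ˢ L) * ψ K
  total≡∑ˢ ψ L = begin
    sum (λ r → ψ (pre r))
      ≡⟨ sum-cong-≗ pick ⟨
    sum (λ r → ∑ˢ λ K → when (does (image (matrix r) K ≟ˢ L)) (ψ K))
      ≡⟨ ∑-∑ˢ-comm (λ r K → when (does (image (matrix r) K ≟ˢ L)) (ψ K)) ⟩
    ∑ˢ (λ K → sum λ r → when (does (image (matrix r) K ≟ˢ L)) (ψ K))
      ≡⟨ ∑ˢ-cong (λ K → trans (sum-cong-≗ λ r → when-* (does (image (matrix r) K ≟ˢ L)) (ψ K))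
           (trans (sym (*-distribʳ-sum (ψ K) λ r → when (does (image (matrix r) K ≟ˢ L)) 1))
                  (cong (_* ψ K) (sym (countFin≡∑ λ r → image (matrix r) K ≟ˢ L))))) ⟩
    ∑ˢ (λ K → countFin (λ r → image (matrix r) K ≟ˢ L) * ψ K) ∎
    where
    open ≡-Reasoning
    pre : Fin (lam * (m C k)) → Subset m
    pre r = preimage (matrix r) L
    pick : ∀ r → ∑ˢ (λ K → when (does (image (matrix r) K ≟ˢ L)) (ψ K)) ≡ ψ (pre r)
    pick r = trans
      (∑ˢ-single _ (pre r) λ K K≢ → cong (λ b → when b (ψ K))
        (dec-false (image (matrix r) K ≟ˢ L) λ im≡L →
          K≢ (trans (sym (preimage-image (rowPerm r) K)) (cong (preimage (matrix r)) im≡L))))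
      (cong (λ b → when b (ψ (pre r)))
        (dec-true (image (matrix r) (pre r) ≟ˢ L) (image-preimage (rowPerm r) L)))

  -- Column sets of size `k` are covered by `balanced`; all others are never mapped onto `L`, since
  -- rows preserve size. The count is thus independent of `L`.
  countFin-image : ∀ K L → ∣ L ∣ ≡ k →
    countFin (λ r → image (matrix r) K ≟ˢ L) ≡ when (does (∣ K ∣ ℕ.≟ k)) lam
  countFin-image K L ∣L∣ = go (∣ K ∣ ℕ.≟ k)
    where
    go : (d : Dec (∣ K ∣ ≡ k)) →
         countFin (λ r → image (matrix r) K ≟ˢ L) ≡ when (does d) lam
    go (yes ∣K∣)  = balanced K L ∣K∣ ∣L∣
    go (no ∣K∣≢k) = trans (countFin≡∑ λ r → image (matrix r) K ≟ˢ L)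
      (∑-zero _ λ r → cong (λ b → when b 1) (dec-false (image (matrix r) K ≟ˢ L) λ im≡L →
        ∣K∣≢k (trans (cong ∣_∣ (trans (sym (preimage-image (rowPerm r) K))
                                      (cong (preimage (matrix r)) im≡L)))
                     (trans (∣preimage∣ (rowPerm r) L) ∣L∣))))

  rows-homogeneous : Homogeneous rowPerm k
  rows-homogeneous ψ K L ∣K∣ ∣L∣ = begin
    total rowPerm ψ K                              ≡⟨ total≡∑ˢ ψ K ⟩
    ∑ˢ (λ J → countFin (λ r → image (matrix r) J ≟ˢ K) * ψ J)
      ≡⟨ ∑ˢ-cong (λ J → cong (_* ψ J)
           (trans (countFin-image J K ∣K∣) (sym (countFin-image J L ∣L∣)))) ⟩
    ∑ˢ (λ J → countFin (λ r → image (matrix r) J ≟ˢ L) * ψ J) ≡⟨ total≡∑ˢ ψ L ⟨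
    total rowPerm ψ L                              ∎
    where open ≡-Reasoning

-- One-point extensions and the blocks through a t-set.

extension : (Subset n → ℕ) → Subset n → ℕ
extension h T = sum λ x → unless (lookup T x) (h (T [ x ]≔ true))

⊑-size : (K L : Subset n) → K ⊑ L → ∣ K ∣ ≤ ∣ L ∣
⊑-size K L K⊑L = p⊆q⇒∣p∣≤∣q∣ {p = K} λ {x} x∈K → lookup⇒[]= x L (K⊑L x ([]=⇒lookup x∈K))

⊑∧∣∣≡⇒≡ : (K L : Subset n) → K ⊑ L → ∣ K ∣ ≡ ∣ L ∣ → K ≡ L
⊑∧∣∣≡⇒≡ K L K⊑L eq = lookup-injective same
  where
  same : ∀ x → lookup K x ≡ lookup L x
  same x with lookup K x in x∈K | lookup L x in x∈L
  ... | true  | true  = refl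
  ... | false | false = refl
  ... | true  | false = trans (sym (K⊑L x x∈K)) x∈L
  ... | false | true  = contradiction
    (subst₂ _≤_ (∣∣-insert K x x∈K) (sym eq)
      (⊑-size (K [ x ]≔ true) L (insert-⊑ {K = K} {L = L} K⊑L x∈L)))
    1+n≰n

add-one : (T b : Subset n) → T ⊆ b → ∣ b ∣ ≡ suc ∣ T ∣ →
          ∃ λ x → lookup T x ≡ false × b ≡ T [ x ]≔ true
add-one T b T⊆b ∣b∣ with find-outside T b (≤-reflexive (sym ∣b∣))
... | x , x∉T , x∈b = x , x∉T ,
  sym (⊑∧∣∣≡⇒≡ (T [ x ]≔ true) b (insert-⊑ {K = T} {L = b} T⊑b x∈b)
                (trans (∣∣-insert T x x∉T) (sym ∣b∣)))
  where
  T⊑b : T ⊑ b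
  T⊑b y y∈T = []=⇒lookup (T⊆b (lookup⇒[]= y T y∈T))

module _ {t} (S : SteinerSystem t (suc t) n) where
  open SteinerSystem S

  -- Blocks have size t + 1, so a block containing `T` is `T` with one added point, and `cover`
  -- provides exactly one.
  extension-block : ∀ T → ∣ T ∣ ≡ t → extension (λ K → when (does (block? K)) 1) T ≡ 1
  extension-block T ∣T∣ with cover T ∣T∣
  ... | b , (isBlock , T⊆b) , unique
    with add-one T b T⊆b (trans (block-size isBlock) (cong suc (sym ∣T∣)))
  ... | x , x∉T , refl = trans (∑-single _ x other) at
    where
    at : unless (lookup T x) (when (does (block? (T [ x ]≔ true))) 1) ≡ 1
    at rewrite x∉T = cong (λ c → when c 1) (dec-true (block? (T [ x ]≔ true)) isBlock)
    other : ∀ y → y ≢ x → unless (lookup T y) (when (does (block? (T [ y ]≔ true))) 1) ≡ 0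
    other y y≢x with lookup T y in y∉T
    ... | true  = refl
    -- By uniqueness a second block T ∪ y would equal T ∪ x, but only the former contains `y`.
    ... | false = cong (λ c → when c 1) (dec-false (block? (T [ y ]≔ true)) λ blk →
      contradiction
        (trans (sym (lookup∘update y T true))
          (trans (cong (λ c → lookup c y) (sym (unique (blk , T⊆T⁺))))
            (trans (lookup∘update′ y≢x T true) y∉T)))
        λ ())
      where
      T⊆T⁺ : T ⊆ (T [ y ]≔ true)
      T⊆T⁺ {z} z∈T = lookup⇒[]= z (T [ y ]≔ true) (lemma (z ≟ y))
        where
        lemma : Dec (z ≡ y) → lookup (T [ y ]≔ true) z ≡ true
        lemma (yes refl) = lookup∘update y T true
        lemma (no z≢y)   = trans (lookup∘update′ z≢y T true) ([]=⇒lookup z∈T)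

-- Relabelling a Steiner system.

preimage-⊆ : ∀ (f : Fin m → Fin n) {K L} → K ⊆ L → preimage f K ⊆ preimage f L
preimage-⊆ f {K} {L} K⊆L {x} x∈ = lookup⇒[]= x (preimage f L)
  (trans (lookup-preimage f L x) ([]=⇒lookup (K⊆L (lookup⇒[]= (f x) K
    (trans (sym (lookup-preimage f K x)) ([]=⇒lookup x∈))))))

-- The new blocks are the images of the old ones under `π`, recognised by pulling back; covers are
-- transported along `π` and its inverse.
relabel : ∀ {t} → Permutation′ n → SteinerSystem t k n → SteinerSystem t k n
relabel π S = record
  { Block      = Block ∘ preimage f
  ; block?     = λ K → block? (preimage f K)
  ; block-size = λ {b} blk → trans (sym (∣preimage∣ π b)) (block-size blk)
  ; cover      = λ T ∣T∣ → cover′ T (cover (preimage f T) (trans (∣preimage∣ π T) ∣T∣))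
  }
  where
  open SteinerSystem S
  f = π ⟨$⟩ʳ_
  g = π ⟨$⟩ˡ_
  gf : ∀ K → preimage f (preimage g K) ≡ K
  gf = preimage-∘ {f = g} {f} λ x → inverseˡ π
  fg : ∀ K → preimage g (preimage f K) ≡ K
  fg = preimage-∘ {f = f} {g} λ x → inverseʳ π
  cover′ : ∀ T → ∃! _≡_ (λ b → Block b × preimage f T ⊆ b) →
           ∃! _≡_ (λ b → Block (preimage f b) × T ⊆ b)
  cover′ T (b , (blk , T⊆b) , unique) =
    preimage g b ,
    (subst Block (sym (gf b)) blk ,
     subst (_⊆ preimage g b) (fg T) (preimage-⊆ g T⊆b)) ,
    λ {c} (blk′ , T⊆c) → trans (cong (preimage g) (unique (blk′ , preimage-⊆ f T⊆c))) (fg c)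

-- Arithmetic of the counting equations.

∑-unless-const : ∀ (U : Subset m) {f : Vector ℕ m} {c} → (∀ x → lookup U x ≡ false → f x ≡ c) →
                 sum (λ x → unless (lookup U x) (f x)) + ∣ U ∣ * c ≡ m * c
∑-unless-const {m} U {f} {c} f≡c = begin
  sum (λ x → unless (lookup U x) (f x)) + ∣ U ∣ * c
    ≡⟨ cong (_ +_) (shadow-const c U) ⟨
  sum (λ x → unless (lookup U x) (f x)) + sum (λ x → when (lookup U x) c)
    ≡⟨ ∑-distrib-+ (λ x → unless (lookup U x) (f x)) _ ⟨
  sum (λ x → unless (lookup U x) (f x) + when (lookup U x) c)
    ≡⟨ sum-cong-≗ (λ x → at (lookup U x) (f≡c x)) ⟩
  sum {m} (λ _ → c)
    ≡⟨ ∑-const m c ⟩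
  m * c ∎
  where
  open ≡-Reasoning
  at : ∀ b {v} → (b ≡ false → v ≡ c) → unless b v + when b c ≡ c
  at true  eq = refl
  at false eq = trans (+-identityʳ _) (eq refl)

-- Absorption by Pascal's rule: one copy of `a` splits off, and two smaller instances recombine to
-- (n+1) · a.
[1+k]*[1+n]C[1+k]≡[1+n]*nCk : ∀ n k → suc k * (suc n C suc k) ≡ suc n * (n C k)
[1+k]*[1+n]C[1+k]≡[1+n]*nCk n       zero    = trans (*-identityˡ _) (trans (nC1≡n (suc n)) (sym (*-identityʳ _)))
[1+k]*[1+n]C[1+k]≡[1+n]*nCk zero    (suc k) = *-zeroʳ k
[1+k]*[1+n]C[1+k]≡[1+n]*nCk (suc n) (suc k) = begin
  (2 + k) * (suc (suc n) C suc (suc k))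
    ≡⟨ cong ((2 + k) *_) (nCk+nC[k+1]≡[n+1]C[k+1] (suc n) (suc k)) ⟨
  (2 + k) * (a + b)
    ≡⟨ expand k a b ⟩
  (suc k * a + (2 + k) * b) + a
    ≡⟨ cong (_+ a) (cong₂ _+_ ([1+k]*[1+n]C[1+k]≡[1+n]*nCk n k)
                              ([1+k]*[1+n]C[1+k]≡[1+n]*nCk n (suc k))) ⟩
  (suc n * (n C k) + suc n * (n C suc k)) + a
    ≡⟨ cong (_+ a) (*-distribˡ-+ (suc n) (n C k) (n C suc k)) ⟨
  suc n * (n C k + n C suc k) + a
    ≡⟨ cong (λ v → suc n * v + a) (nCk+nC[k+1]≡[n+1]C[k+1] n k) ⟩
  suc n * a + a
    ≡⟨ +-comm (suc n * a) a ⟩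
  (2 + n) * a ∎
  where
  open ≡-Reasoning
  a = suc n C suc k
  b = suc n C suc (suc k)
  expand : ∀ k a b → (2 + k) * (a + b) ≡ (suc k * a + (2 + k) * b) + a
  expand = solve-∀

-- The equation says (m - u)(ν - μ) = 0, and m - u = d + 1 is positive.
balanced⇒≡ : ∀ {u d m μ ν} → suc (u + d) ≡ m → u * μ + m * ν ≡ m * μ + u * ν → ν ≡ μ
balanced⇒≡ {u} {d} {_} {μ} {ν} refl eq = *-cancelˡ-≡ ν μ (suc d)
  (+-cancelˡ-≡ (u * μ + u * ν) _ _ (trans (left u d μ ν) (trans eq (right u d μ ν))))
  where
  left : ∀ u d μ ν → (u * μ + u * ν) + suc d * ν ≡ u * μ + suc (u + d) * ν
  left = solve-∀
  right : ∀ u d μ ν → suc (u + d) * μ + u * ν ≡ (u * μ + u * ν) + suc d * μ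
  right = solve-∀

-- The large set and its multiplicity.

module _ {lam m} (7≤m : 7 ≤ m) (S : SteinerSystem 3 4 (3 + m)) (P : PerpendicularArray lam 4 m m) where

  private
    R : ℕ
    R = lam * (m C 4)

  -- `lift₀` adds a fixed point in front, so pulling back a ∷ b ∷ c ∷ K computes to the same three
  -- entries followed by the pulled-back tail.
  fixing₃ : Fin R → Permutation′ (3 + m)
  fixing₃ r = lift₀ (lift₀ (lift₀ (rowPerm P r)))

  system : Fin R → SteinerSystem 3 4 (3 + m)
  system r = relabel (fixing₃ r) S

  isBlock : Fin R → Subset (3 + m) → ℕ
  isBlock r K = when (does (SteinerSystem.block? (system r) K)) 1

  multiplicity : Subset (3 + m) → ℕ
  multiplicity K = sum λ r → isBlock r K

  hom₄ : Homogeneous (rowPerm P) 4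
  hom₄ = rows-homogeneous P

  -- The descent from 4 to 3 is the most demanding one: 2 · 3 + 1 = 7 ≤ m.
  hom₃ : Homogeneous (rowPerm P) 3
  hom₃ = homogeneous-pred (rowPerm P) 7≤m hom₄

  hom₂ : Homogeneous (rowPerm P) 2
  hom₂ = homogeneous-pred (rowPerm P) (≤-trans (m≤m+n 5 2) 7≤m) hom₃

  hom₁ : Homogeneous (rowPerm P) 1
  hom₁ = homogeneous-pred (rowPerm P) (≤-trans (m≤m+n 3 4) 7≤m) hom₂

  homogeneous : ∀ k → 1 ≤ k → k ≤ 4 → Homogeneous (rowPerm P) k
  homogeneous 1 _ _ = hom₁
  homogeneous 2 _ _ = hom₂
  homogeneous 3 _ _ = hom₃
  homogeneous 4 _ _ = hom₄
  homogeneous (suc (suc (suc (suc (suc k))))) _ (s≤s (s≤s (s≤s (s≤s ()))))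

  -- Each of the `R` systems contributes exactly one block through `T`.
  extension-multiplicity : ∀ T → ∣ T ∣ ≡ 3 → extension multiplicity T ≡ R
  extension-multiplicity T ∣T∣ = begin
    sum (λ x → unless (lookup T x) (sum λ r → isBlock r (T [ x ]≔ true)))
      ≡⟨ sum-cong-≗ (λ x → unless-∑ (lookup T x) (λ r → isBlock r (T [ x ]≔ true))) ⟩
    sum (λ x → sum λ r → unless (lookup T x) (isBlock r (T [ x ]≔ true)))
      ≡⟨ ∑-comm (λ x r → unless (lookup T x) (isBlock r (T [ x ]≔ true))) ⟩
    sum (λ r → extension (isBlock r) T)
      ≡⟨ sum-cong-≗ (λ r → extension-block (system r) T ∣T∣) ⟩
    sum {R} (λ _ → 1)
      ≡⟨ ∑-const R 1 ⟩
    R * 1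
      ≡⟨ *-identityʳ R ⟩
    R ∎
    where
    open ≡-Reasoning
    unless-∑ : ∀ b (f : Vector ℕ R) → unless b (sum f) ≡ sum (λ r → unless b (f r))
    unless-∑ true  f = sym (sum-replicate-zero R)
    unless-∑ false f = refl

  -- For fixed `a`, `b`, `c` the multiplicity is a `total` over the rows, weighted by the block
  -- indicator of the tail.
  multiplicity-cong : ∀ a b c (K L : Subset m) → 1 ≤ ∣ K ∣ → ∣ K ∣ ≤ 4 → ∣ L ∣ ≡ ∣ K ∣ →
    multiplicity (a ∷ b ∷ c ∷ K) ≡ multiplicity (a ∷ b ∷ c ∷ L)
  multiplicity-cong a b c K L 1≤ ≤4 ∣L∣≡∣K∣ = homogeneous ∣ K ∣ 1≤ ≤4
    (λ J → when (does (SteinerSystem.block? S (a ∷ b ∷ c ∷ J))) 1) K L refl ∣L∣≡∣K∣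

  fixedPart : Bool → Bool → Bool → Subset m → ℕ
  fixedPart a b c U =
    unless a (multiplicity (true ∷ b ∷ c ∷ U)) +
    (unless b (multiplicity (a ∷ true ∷ c ∷ U)) +
     unless c (multiplicity (a ∷ b ∷ true ∷ U)))

  -- For T = a ∷ b ∷ c ∷ U, completions by a fixed point give `fixedPart`, and the m - |U| others
  -- all have the multiplicity of a ∷ b ∷ c ∷ L. The subtracted term stands on the right to stay in
  -- ℕ.
  remove-point : ∀ a b c (L : Subset m) → ∣ a ∷ b ∷ c ∷ L ∣ ≡ 4 → 1 ≤ ∣ L ∣ →
    ∃ λ U → suc ∣ U ∣ ≡ ∣ L ∣ × ∣ a ∷ b ∷ c ∷ U ∣ ≡ 3 ×
            fixedPart a b c U + m * multiplicity (a ∷ b ∷ c ∷ L) ≡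
            R + ∣ U ∣ * multiplicity (a ∷ b ∷ c ∷ L)
  remove-point a b c L ∣abcL∣ 1≤∣L∣
    with find-outside ⊥ L (subst (_< ∣ L ∣) (sym (∣⊥∣≡0 m)) 1≤∣L∣)
  ... | p , _ , p∈L = U , ∣U∣ , ∣abcU∣ , (begin
    fixedPart a b c U + m * ν
      ≡⟨ cong (fixedPart a b c U +_) (∑-unless-const U completions) ⟨
    fixedPart a b c U + (S′ + ∣ U ∣ * ν)
      ≡⟨ regroup (unless a _) (unless b _) (unless c _) S′ (∣ U ∣ * ν) ⟩
    extension multiplicity (a ∷ b ∷ c ∷ U) + ∣ U ∣ * ν
      ≡⟨ cong (_+ ∣ U ∣ * ν) (extension-multiplicity (a ∷ b ∷ c ∷ U) ∣abcU∣) ⟩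
    R + ∣ U ∣ * ν ∎)
    where
    open ≡-Reasoning
    U = L [ p ]≔ false
    ν = multiplicity (a ∷ b ∷ c ∷ L)
    S′ = sum λ x → unless (lookup U x) (multiplicity (a ∷ b ∷ c ∷ (U [ x ]≔ true)))
    ∣U∣ : suc ∣ U ∣ ≡ ∣ L ∣
    ∣U∣ = ∣∣-delete L p p∈L
    ∣abcU∣ : ∣ a ∷ b ∷ c ∷ U ∣ ≡ 3
    ∣abcU∣ = suc-injective (trans (∣∣-delete (a ∷ b ∷ c ∷ L) (suc (suc (suc p))) p∈L) ∣abcL∣)
    ∣L∣≤4 : ∣ L ∣ ≤ 4
    ∣L∣≤4 = ≤-trans (∣∣-tail a b c) (≤-reflexive ∣abcL∣)
      where
      ∣∣-∷ : ∀ {n} x (K : Subset n) → ∣ K ∣ ≤ ∣ x ∷ K ∣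
      ∣∣-∷ true  K = n≤1+n _
      ∣∣-∷ false K = ≤-refl
      ∣∣-tail : ∀ a b c → ∣ L ∣ ≤ ∣ a ∷ b ∷ c ∷ L ∣
      ∣∣-tail a b c = ≤-trans (∣∣-∷ c L) (≤-trans (∣∣-∷ b (c ∷ L)) (∣∣-∷ a (b ∷ c ∷ L)))
    completions : ∀ x → lookup U x ≡ false → multiplicity (a ∷ b ∷ c ∷ (U [ x ]≔ true)) ≡ ν
    completions x x∉U = sym (multiplicity-cong a b c L (U [ x ]≔ true) 1≤∣L∣ ∣L∣≤4
      (trans (∣∣-insert U x x∉U) ∣U∣))
    regroup : ∀ x y z s t → (x + (y + z)) + (s + t) ≡ (x + (y + (z + s))) + t
    regroup = solve-∀

  singleton : Subset m
  singleton = ⊥ [ fromℕ< (≤-trans (s≤s z≤n) 7≤m) ]≔ true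

  ∣singleton∣ : ∣ singleton ∣ ≡ 1
  ∣singleton∣ = trans (∣∣-insert ⊥ x (lookup-replicate x false)) (cong suc (∣⊥∣≡0 m))
    where
    x = fromℕ< (≤-trans (s≤s z≤n) 7≤m)

  μ : ℕ
  μ = multiplicity (true ∷ true ∷ true ∷ singleton)

  -- Here `T` consists of the three fixed points: `U` is empty and no fixed point is left to add.
  R≡m*μ : R ≡ m * μ
  R≡m*μ = conclude (remove-point true true true singleton (cong (3 +_) ∣singleton∣)
                                 (≤-reflexive (sym ∣singleton∣)))
    where
    conclude : (∃ λ U → suc ∣ U ∣ ≡ ∣ singleton ∣ × ∣ true ∷ true ∷ true ∷ U ∣ ≡ 3 ×
                        m * μ ≡ R + ∣ U ∣ * μ) → R ≡ m * μ
    conclude (U , ∣U∣ , _ , eq) =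
      sym (trans eq (trans (cong (λ u → R + u * μ) ∣U∣≡0) (+-identityʳ R)))
      where
      ∣U∣≡0 : ∣ U ∣ ≡ 0
      ∣U∣≡0 = suc-injective (trans ∣U∣ ∣singleton∣)

  -- A 3-set misses as many fixed points as it has other points, so its fixed part is |U| · μ once
  -- those completions have multiplicity μ. Together with R = m · μ the count forces equality.
  multiplicity-step : ∀ a b c → (∀ U → ∣ a ∷ b ∷ c ∷ U ∣ ≡ 3 → fixedPart a b c U ≡ ∣ U ∣ * μ) →
         ∀ L → 1 ≤ ∣ L ∣ → ∣ a ∷ b ∷ c ∷ L ∣ ≡ 4 → multiplicity (a ∷ b ∷ c ∷ L) ≡ μ
  multiplicity-step a b c fixed≡ L 1≤∣L∣ ∣abcL∣ = conclude (remove-point a b c L ∣abcL∣ 1≤∣L∣)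
    where
    ν = multiplicity (a ∷ b ∷ c ∷ L)
    conclude : (∃ λ U → suc ∣ U ∣ ≡ ∣ L ∣ × ∣ a ∷ b ∷ c ∷ U ∣ ≡ 3 ×
                        fixedPart a b c U + m * ν ≡ R + ∣ U ∣ * ν) → ν ≡ μ
    conclude (U , ∣U∣ , ∣abcU∣ , eq) = balanced⇒≡ {u = ∣ U ∣}
      (trans (cong (_+ (m ∸ ∣ L ∣)) ∣U∣) (m+[n∸m]≡n (∣p∣≤n L)))
      (trans (cong (_+ m * ν) (sym (fixed≡ U ∣abcU∣))) (trans eq (cong (_+ ∣ U ∣ * ν) R≡m*μ)))

  -- The cases go from three fixed points in `K` down to none, each resting on those with one more.
  multiplicity≡μ : ∀ K → ∣ K ∣ ≡ 4 → multiplicity K ≡ μ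
  multiplicity≡μ (a ∷ b ∷ c ∷ L) = go a b c L
    where
    1≤ : ∀ {k l} → l ≡ suc k → 1 ≤ l
    1≤ refl = s≤s z≤n
    ttt : ∀ L → ∣ L ∣ ≡ 1 → multiplicity (true ∷ true ∷ true ∷ L) ≡ μ
    ttt L ∣L∣ = multiplicity-cong true true true L singleton (1≤ ∣L∣) (≤-trans (≤-reflexive ∣L∣) (s≤s z≤n))
                                  (trans ∣singleton∣ (sym ∣L∣))
    ttf : ∀ L → ∣ L ∣ ≡ 2 → multiplicity (true ∷ true ∷ false ∷ L) ≡ μ
    ttf L ∣L∣ = multiplicity-step true true false (λ U e → let e′ = suc-injective (suc-injective e) in
      trans (ttt U e′) (sym (trans (cong (_* μ) e′) (+-identityʳ μ)))) L (1≤ ∣L∣) (cong (2 +_) ∣L∣)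
    tft : ∀ L → ∣ L ∣ ≡ 2 → multiplicity (true ∷ false ∷ true ∷ L) ≡ μ
    tft L ∣L∣ = multiplicity-step true false true (λ U e → let e′ = suc-injective (suc-injective e) in
      trans (cong (_+ 0) (ttt U e′)) (cong (_* μ) (sym e′))) L (1≤ ∣L∣) (cong (2 +_) ∣L∣)
    ftt : ∀ L → ∣ L ∣ ≡ 2 → multiplicity (false ∷ true ∷ true ∷ L) ≡ μ
    ftt L ∣L∣ = multiplicity-step false true true (λ U e → let e′ = suc-injective (suc-injective e) in
      trans (cong (_+ 0) (ttt U e′)) (cong (_* μ) (sym e′))) L (1≤ ∣L∣) (cong (2 +_) ∣L∣)
    tff : ∀ L → ∣ L ∣ ≡ 3 → multiplicity (true ∷ false ∷ false ∷ L) ≡ μ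
    tff L ∣L∣ = multiplicity-step true false false (λ U e → let e′ = suc-injective e in
      trans (cong₂ _+_ (ttf U e′) (trans (tft U e′) (sym (+-identityʳ μ)))) (cong (_* μ) (sym e′)))
      L (1≤ ∣L∣) (cong suc ∣L∣)
    ftf : ∀ L → ∣ L ∣ ≡ 3 → multiplicity (false ∷ true ∷ false ∷ L) ≡ μ
    ftf L ∣L∣ = multiplicity-step false true false (λ U e → let e′ = suc-injective e in
      trans (cong₂ _+_ (ttf U e′) (trans (ftt U e′) (sym (+-identityʳ μ)))) (cong (_* μ) (sym e′)))
      L (1≤ ∣L∣) (cong suc ∣L∣)
    fft : ∀ L → ∣ L ∣ ≡ 3 → multiplicity (false ∷ false ∷ true ∷ L) ≡ μ
    fft L ∣L∣ = multiplicity-step false false true (λ U e → let e′ = suc-injective e in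
      trans (cong₂ _+_ (tft U e′) (cong (_+ 0) (ftt U e′))) (cong (_* μ) (sym e′)))
      L (1≤ ∣L∣) (cong suc ∣L∣)
    fff : ∀ L → ∣ L ∣ ≡ 4 → multiplicity (false ∷ false ∷ false ∷ L) ≡ μ
    fff L ∣L∣ = multiplicity-step false false false (λ U e →
      trans (cong₂ _+_ (tff U e) (cong₂ _+_ (ftf U e) (trans (fft U e) (sym (+-identityʳ μ)))))
            (cong (_* μ) (sym e)))
      L (1≤ ∣L∣) ∣L∣
    go : ∀ a b c L → ∣ a ∷ b ∷ c ∷ L ∣ ≡ 4 → multiplicity (a ∷ b ∷ c ∷ L) ≡ μ
    go true  true  true  L e = ttt L (suc-injective (suc-injective (suc-injective e)))
    go true  true  false L e = ttf L (suc-injective (suc-injective e))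
    go true  false true  L e = tft L (suc-injective (suc-injective e))
    go false true  true  L e = ftt L (suc-injective (suc-injective e))
    go true  false false L e = tff L (suc-injective e)
    go false true  false L e = ftf L (suc-injective e)
    go false false true  L e = fft L (suc-injective e)
    go false false false L e = fff L e

  largeSet : LargeSet 3 4 (3 + m) μ
  largeSet = record
    { size     = R
    ; system   = system
    ; multiple = λ K ∣K∣ →
        trans (countFin≡∑ λ r → SteinerSystem.block? (system r) K) (multiplicity≡μ K ∣K∣)
    }

  -- From m · μ = λ · C(m,4) and 4 · C(m,4) = m · C(m-1,3), after cancelling m.
  4*μ≡ : 4 * μ ≡ lam * ((m ∸ 1) C 3)
  4*μ≡ = go m 7≤m R≡m*μ
    where
    open ≡-Reasoning
    go : ∀ m → 7 ≤ m → ∀ {μ} → lam * (m C 4) ≡ m * μ → 4 * μ ≡ lam * ((m ∸ 1) C 3)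
    go (suc m) _ {μ} eq = *-cancelˡ-≡ _ _ (suc m) (begin
      suc m * (4 * μ)              ≡⟨ swap (suc m) 4 μ ⟩
      4 * (suc m * μ)              ≡⟨ cong (4 *_) eq ⟨
      4 * (lam * (suc m C 4))      ≡⟨ swap 4 lam (suc m C 4) ⟩
      lam * (4 * (suc m C 4))      ≡⟨ cong (lam *_) ([1+k]*[1+n]C[1+k]≡[1+n]*nCk m 3) ⟩
      lam * (suc m * (m C 3))      ≡⟨ swap lam (suc m) (m C 3) ⟩
      suc m * (lam * (m C 3))      ∎)
      where
      swap : ∀ a b c → a * (b * c) ≡ b * (a * c)
      swap = solve-∀

-- LargeSet does not mention A and B, so the three fixed points may be taken to be the
-- first three elements of Fin n.
theorem19 : (n : ℕ) → 14 ≤ n →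
    (S : SteinerSystem 3 4 n) →
    (A B : Subset n) → A ∪ B ≡ ⊤ → A ∩ B ≡ ⊥ → ∣ A ∣ ≡ 3 → ∣ B ∣ ≡ n ∸ 3 →
    (lam : ℕ) → PerpendicularArray lam 4 (n ∸ 3) (n ∸ 3) →
    ∃[ μ ] ((4 * μ ≡ lam * ((n ∸ 4) C 3)) × LargeSet 3 4 n μ)
theorem19 (suc (suc (suc m))) (s≤s (s≤s (s≤s 11≤m))) S A B _ _ _ _ lam P =
  μ 7≤m S P , 4*μ≡ 7≤m S P , largeSet 7≤m S P
  where
  -- From n ≥ 14 one has m = n - 3 ≥ 11, which gives the bound for the descent.
  7≤m = ≤-trans (m≤m+n 7 4) 11≤m
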